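{- Let $m$ be an odd positive integer, and consider integer representations by the quadratic form $x^2+y^2+2z^2+2w^2$. (i) The number of $(x,y,z,w)\in\mathbb{Z}^4$ with $x^2+y^2+2z^2+2w^2=4m$, $x,y$ even and $z,w$ odd, is $4\sigma(m)$. (ii) The number of $(x,y,z,w)\in\mathbb{Z}^4$ with $x^2+y^2+2z^2+2w^2=8m$, $x,y$ even and $z,w$ odd, is $16\sigma(m)$. (iii) The number of $(x,y,z,w)\in\mathbb{Z}^4$ with $x^2+y^2+2z^2+2w^2=4m$, $x,y$ odd and $z,w$ of different parity, is $16\sigma(m)$.
   Context: $\sigma(m)$ denotes the sum of the positive divisors of $m$. -}

module Defs where

open import Data.Fin using (Fin)
open import Data.Integer using (ℤ; +_; _+_; _*_; _^_)
open import Data.Integer.Divisibility using (_∣_)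
open import Data.List using (filter; map; upTo)
open import Data.Nat using (ℕ; suc)
open import Data.Nat.Divisibility using (_∣?_)
open import Data.Nat.ListAction using (sum)
open import Data.Product using (_×_; _,_; proj₁)
open import Data.Sum using (_⊎_)
open import Function.Bundles using (Inverse)
open import Level using (Level; _⊔_)
import Relation.Binary.Construct.On as On
open import Relation.Binary.PropositionalEquality using (setoid)
open import Relation.Nullary using (¬_)
open import Relation.Unary using (Pred)

private
  variable
    a p : Level

σ : ℕ → ℕ
σ m = sum (filter (_∣? m) (map suc (upTo m)))

Even Odd : ℤ → Set
Even x = + 2 ∣ x
Odd x = ¬ Even x

DifferentParity : ℤ → ℤ → Set
DifferentParity x y = (Even x × Odd y) ⊎ (Odd x × Even y)

ℤ⁴ : Set
ℤ⁴ = ℤ × ℤ × ℤ × ℤ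

Q : ℤ → ℤ → ℤ → ℤ → ℤ
Q x y z w = x ^ 2 + y ^ 2 + + 2 * z ^ 2 + + 2 * w ^ 2

-- The elements satisfying P are compared by their underlying element only, so
-- that different proofs of P for the same element are not counted separately.
HasCardinality : {A : Set a} → Pred A p → ℕ → Set (a ⊔ p)
HasCardinality {A = A} P n =
  Inverse (On.setoid (setoid A) (proj₁ {B = P})) (setoid (Fin n))

{-# OPTIONS --safe #-}
module Submission where

-- Write p(k) = k(k+1). Linear substitutions turn all three counts into the
-- number r(n) of (i,j,k,l) ∈ ℤ⁴ with p(i)+p(j)+p(k)+p(l) = n = m−1, that is, of
-- representations of 4m as a sum of four odd squares (for the first count, only
-- the quarter of them with i+j and k+l even occurs). So r = 16 s is needed for
-- s(n) = Σ (2a+1) over (2a+1)(2b+1) = n+1. Both functions satisfy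
--   Σ_{k∈ℤ} (n − 5p(k)) f(n − p(k)) = 0   for all n,
-- which determines f from f(0). For r this is the symmetry of n as a sum of five
-- pronic numbers. For s put x = 2k+1, d = 2a+1, δ = 2b+1: the sum becomes
-- Σ (dδ − x²)d over x² + 4dδ = 4n+5, and up to the symmetries x ↦ −x and d ↔ δ
-- it is half the sum of u = (d+δ)(δ−x)(d+x). The latter vanishes:
-- (x,d,δ) ↦ (−x−2d, d, δ−x−d) is an involution of the part δ > x+d reversing the
-- sign of u, and (x,d,δ) ↦ (−x,δ,d) exchanges the two parts and preserves u.

open import Defs
open import Algebra.Bundles using (AbelianGroup)
open import Data.Empty using (⊥-elim)
open import Data.Fin using (Fin; zero; suc)
open import Data.Integer as ℤ using (ℤ; +_; -[1+_]; -_; _+_; _*_; _-_; ∣_∣)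
open import Data.Integer.Divisibility.Signed as Signed using (divides; ∣ᵤ⇒∣; ∣⇒∣ᵤ; ∣m+n∣m⇒∣n)
import Data.Integer.Properties as ℤ
open import Data.Integer.Tactic.RingSolver using (solve-∀)
open import Data.List using (List; []; _∷_; _++_; map; filter; concatMap; length; lookup; upTo; cartesianProduct)
open import Data.List.Membership.Propositional using (_∈_)
open import Data.List.Membership.Propositional.Properties
open import Data.List.Membership.Propositional.Properties.WithK using (unique⇒irrelevant; unique∧set⇒bag)
open import Data.List.Properties using (length-map)
open import Data.List.Relation.Binary.BagAndSetEquality using (∼bag⇒↭)
open import Data.List.Relation.Binary.Permutation.Propositional as Perm using (_↭_)
open import Data.List.Relation.Unary.All as All using ([]; _∷_)
open import Data.List.Relation.Unary.AllPairs using ([]; _∷_)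
open import Data.List.Relation.Unary.Any using (here; there; index)
open import Data.List.Relation.Unary.Any.Properties using (lookup-index)
open import Data.List.Relation.Unary.Unique.Propositional using (Unique)
import Data.List.Relation.Unary.Unique.Propositional.Properties as Unique
open import Data.Nat as ℕ using (ℕ; zero; suc; z≤n; s≤s)
import Data.Nat.Divisibility as ℕ
import Data.Nat.Induction as ℕ
open import Data.Nat.ListAction using (sum)
import Data.Nat.Properties as ℕ
import Data.Nat.Tactic.RingSolver as ℕSolver
open import Data.Product using (∃; _×_; _,_; proj₁; proj₂)
open import Data.Sum using (_⊎_; inj₁; inj₂)
open import Data.Unit using (⊤; tt)
open import Function using (_∘_)
open import Function.Bundles using (mk⇔)
open import Relation.Binary.PropositionalEquality
open import Relation.Nullary using (¬_; yes; no; ¬?)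
open import Relation.Unary using (Decidable)

open import Algebra.Properties.Group (AbelianGroup.group ℤ.+-0-abelianGroup)
  using () renaming (∙-cancelˡ to +-cancelˡ; ∙-cancelʳ to +-cancelʳ)

open ≡-Reasoning

private
  variable
    A B : Set


-- Integer-valued sums over lists.

+-congˡ : ∀ i {j k} → j ≡ k → i + j ≡ i + k
+-congˡ i = cong (λ j → i + j)

∑ : List A → (A → ℤ) → ℤ
∑ []       g = + 0
∑ (x ∷ xs) g = g x + ∑ xs g

∑-cong : {g h : A → ℤ} (xs : List A) → (∀ {x} → x ∈ xs → g x ≡ h x) → ∑ xs g ≡ ∑ xs h
∑-cong []       eq = refl
∑-cong (x ∷ xs) eq = cong₂ _+_ (eq (here refl)) (∑-cong xs (eq ∘ there))

∑-zero : (xs : List A) → ∑ xs (λ _ → + 0) ≡ + 0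
∑-zero []       = refl
∑-zero (x ∷ xs) = trans (ℤ.+-identityˡ _) (∑-zero xs)

∑-+ : (g h : A → ℤ) (xs : List A) → ∑ xs (λ x → g x + h x) ≡ ∑ xs g + ∑ xs h
∑-+ g h []       = refl
∑-+ g h (x ∷ xs) = trans (+-congˡ (g x + h x) (∑-+ g h xs)) (interchange (g x) (h x) (∑ xs g) (∑ xs h))
  where
  interchange : ∀ a b c d → a + b + (c + d) ≡ a + c + (b + d)
  interchange = solve-∀

∑-*ˡ : (c : ℤ) (g : A → ℤ) (xs : List A) → ∑ xs (λ x → c * g x) ≡ c * ∑ xs g
∑-*ˡ c g []       = sym (ℤ.*-zeroʳ c)
∑-*ˡ c g (x ∷ xs) = trans (+-congˡ (c * g x) (∑-*ˡ c g xs)) (sym (ℤ.*-distribˡ-+ c (g x) (∑ xs g)))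

∑-++ : (g : A → ℤ) (xs ys : List A) → ∑ (xs ++ ys) g ≡ ∑ xs g + ∑ ys g
∑-++ g []       ys = sym (ℤ.+-identityˡ _)
∑-++ g (x ∷ xs) ys = trans (+-congˡ (g x) (∑-++ g xs ys)) (sym (ℤ.+-assoc (g x) (∑ xs g) (∑ ys g)))

∑-map : (g : B → ℤ) (f : A → B) (xs : List A) → ∑ (map f xs) g ≡ ∑ xs (g ∘ f)
∑-map g f []       = refl
∑-map g f (x ∷ xs) = +-congˡ (g (f x)) (∑-map g f xs)

∑-one : (xs : List A) → ∑ xs (λ _ → + 1) ≡ + length xs
∑-one []       = refl
∑-one (x ∷ xs) = +-congˡ (+ 1) (∑-one xs)

∑-↭ : (g : A → ℤ) {xs ys : List A} → xs ↭ ys → ∑ xs g ≡ ∑ ys g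
∑-↭ g Perm.refl          = refl
∑-↭ g (Perm.prep x p)    = +-congˡ (g x) (∑-↭ g p)
∑-↭ g (Perm.swap x y p) =
  trans (cong (λ s → g x + (g y + s)) (∑-↭ g p)) (exchange (g x) (g y) _)
  where
  exchange : ∀ a b c → a + (b + c) ≡ b + (a + c)
  exchange = solve-∀
∑-↭ g (Perm.trans p q)   = trans (∑-↭ g p) (∑-↭ g q)

∑-filter : {P : A → Set} (P? : Decidable P) (g : A → ℤ) (xs : List A) →
           ∑ xs g ≡ ∑ (filter P? xs) g + ∑ (filter (¬? ∘ P?) xs) g
∑-filter P? g [] = refl
∑-filter P? g (x ∷ xs) with P? x
... | yes p = trans (+-congˡ (g x) (∑-filter P? g xs)) (sym (ℤ.+-assoc (g x) _ _))
... | no ¬p = trans (+-congˡ (g x) (∑-filter P? g xs)) (exchange (g x) (∑ (filter P? xs) g) _)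
  where
  exchange : ∀ a b c → a + (b + c) ≡ b + (a + c)
  exchange = solve-∀

-- Repetition-free enumerations, reindexing and involutions.

record Enum (P : A → Set) (xs : List A) : Set where
  field
    unique   : Unique xs
    sound    : ∀ {x} → x ∈ xs → P x
    complete : ∀ {x} → P x → x ∈ xs

open Enum

Enum-filter : {P : A → Set} {Q : A → Set} (Q? : Decidable Q) {xs : List A} →
              Enum P xs → Enum (λ x → P x × Q x) (filter Q? xs)
Enum-filter Q? e .unique   = Unique.filter⁺ Q? (e .unique)
Enum-filter Q? e .sound m  = let m′ , q = ∈-filter⁻ Q? m in e .sound m′ , q
Enum-filter Q? e .complete (p , q) = ∈-filter⁺ Q? (e .complete p) q

-- Injectivity is demanded only between elements satisfying `P`. Some maps used later, such as `φ`
-- with its absolute value, are well behaved only there.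
Enum-map : {P : A → Set} {Q : B → Set} {xs : List A} (f : A → B) →
           (∀ {x} → P x → Q (f x)) →
           (∀ {x y} → P x → P y → f x ≡ f y → x ≡ y) →
           (∀ {y} → Q y → ∃ λ x → P x × y ≡ f x) →
           Enum P xs → Enum Q (map f xs)
Enum-map {P = P} {Q} {xs} f into injective onto e = record
  { unique   = unique-map (e .unique) (e .sound)
  ; sound    = λ m → let x , x∈ , eq = ∈-map⁻ f m in subst Q (sym eq) (into (e .sound x∈))
  ; complete = λ q → let x , p , eq = onto q in subst (_∈ map f xs) (sym eq) (∈-map⁺ f (e .complete p))
  }
  where
  unique-map : ∀ {zs} → Unique zs → (∀ {x} → x ∈ zs → P x) → Unique (map f zs)
  unique-map []       s = []
  unique-map {z ∷ zs} (z∉ ∷ u) s = All.tabulate fresh ∷ unique-map u (s ∘ there)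
    where
    fresh : ∀ {y} → y ∈ map f zs → f z ≢ y
    fresh m fz≡y =
      let x , x∈ , y≡fx = ∈-map⁻ f m
      in All.lookup z∉ x∈ (injective (s (here refl)) (s (there x∈)) (trans fz≡y y≡fx))

Enum-↭ : {P : A → Set} {xs ys : List A} → Enum P xs → Enum P ys → xs ↭ ys
Enum-↭ e e′ = ∼bag⇒↭ (unique∧set⇒bag (e .unique) (e′ .unique)
  (mk⇔ (e′ .complete ∘ e .sound) (e .complete ∘ e′ .sound)))

∑-reindex : {P : A → Set} {Q : B → Set} {xs : List A} {ys : List B} (f : A → B) →
            (∀ {x} → P x → Q (f x)) →
            (∀ {x y} → P x → P y → f x ≡ f y → x ≡ y) →
            (∀ {y} → Q y → ∃ λ x → P x × y ≡ f x) →
            Enum P xs → Enum Q ys → (h : B → ℤ) → ∑ ys h ≡ ∑ xs (h ∘ f)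
∑-reindex {xs = xs} f into injective onto e e′ h =
  trans (∑-↭ h (Enum-↭ e′ (Enum-map f into injective onto e))) (∑-map h f xs)

∑-inverse : {P : A → Set} {Q : B → Set} {xs : List A} {ys : List B} (f : A → B) (g : B → A) →
            (∀ {x} → P x → Q (f x)) → (∀ {y} → Q y → P (g y)) →
            (∀ {x} → P x → g (f x) ≡ x) → (∀ {y} → Q y → f (g y) ≡ y) →
            Enum P xs → Enum Q ys → (h : B → ℤ) → ∑ ys h ≡ ∑ xs (h ∘ f)
∑-inverse f g into into⁻¹ gf fg =
  ∑-reindex f into
    (λ p q eq → trans (sym (gf p)) (trans (cong g eq) (gf q)))
    (λ {y} q → g y , into⁻¹ q , sym (fg q))

-- Reindexing along the involution turns the sum into its own negative, so its double is zero, and 2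
-- can be cancelled in the integers.
∑-antisymmetric : {P : A → Set} {xs : List A} (f : A → A) →
                  (∀ {x} → P x → P (f x)) → (∀ {x} → P x → f (f x) ≡ x) →
                  Enum P xs → (h : A → ℤ) → (∀ {x} → P x → h (f x) ≡ - h x) → ∑ xs h ≡ + 0
∑-antisymmetric {xs = xs} f into invol e h anti =
  ℤ.*-cancelˡ-≡ (+ 2) (∑ xs h) (+ 0) (begin
    + 2 * ∑ xs h                ≡⟨ double (∑ xs h) ⟩
    ∑ xs h + ∑ xs h             ≡⟨ cong (_+ ∑ xs h) (∑-inverse f f into into invol invol e e h) ⟩
    ∑ xs (h ∘ f) + ∑ xs h       ≡⟨ ∑-+ (h ∘ f) h xs ⟨
    ∑ xs (λ x → h (f x) + h x)  ≡⟨ ∑-cong xs (λ m → trans (cong (_+ h _) (anti (e .sound m))) (ℤ.+-inverseˡ (h _))) ⟩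
    ∑ xs (λ _ → + 0)            ≡⟨ ∑-zero xs ⟩
    + 0                         ∎)
  where
  double : ∀ a → + 2 * a ≡ a + a
  double = solve-∀

-- The involution exchanges the elements in `E` with those outside and preserves `h`, so the two
-- parts contribute equally.
∑-halve : {P E : A → Set} (E? : Decidable E) {xs : List A} (f : A → A) →
          (∀ {x} → P x → P (f x)) → (∀ x → f (f x) ≡ x) →
          (∀ {x} → E x → ¬ E (f x)) → (∀ {x} → ¬ E x → E (f x)) →
          Enum P xs → (h : A → ℤ) → (∀ x → h (f x) ≡ h x) → ∑ xs h ≡ + 2 * ∑ (filter E? xs) h
∑-halve E? {xs} f into invol E⇒¬E ¬E⇒E e h inv = begin
  ∑ xs h                                              ≡⟨ ∑-filter E? h xs ⟩
  ∑ (filter E? xs) h + ∑ (filter (¬? ∘ E?) xs) h      ≡⟨ +-congˡ (∑ (filter E? xs) h) other ⟩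
  ∑ (filter E? xs) h + ∑ (filter E? xs) h             ≡⟨ double _ ⟩
  + 2 * ∑ (filter E? xs) h                            ∎
  where
  double : ∀ i → i + i ≡ + 2 * i
  double = solve-∀
  other : ∑ (filter (¬? ∘ E?) xs) h ≡ ∑ (filter E? xs) h
  other = trans
    (∑-inverse f f (λ (p , q) → into p , E⇒¬E q) (λ (p , q) → into p , ¬E⇒E q)
               (λ {x} _ → invol x) (λ {x} _ → invol x) (Enum-filter E? e) (Enum-filter (¬? ∘ E?) e) h)
    (∑-cong (filter E? xs) (λ {x} _ → inv x))

-- An element goes to its position in the list. In a repetition-free list any two membership proofs
-- of an element agree, so the position does not depend on the proof of `P`, as the setoid in
-- `HasCardinality` demands.
Enum⇒HasCardinality : {P : A → Set} {xs : List A} → Enum P xs → HasCardinality P (length xs)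
Enum⇒HasCardinality {xs = xs} e = record
  { to        = λ (_ , p) → index (e .complete p)
  ; from      = λ i → lookup xs i , e .sound (∈-lookup i)
  ; to-cong   = λ { {_ , p} {_ , q} refl → irr (e .complete p) (e .complete q) }
  ; from-cong = cong (lookup xs)
  ; inverse   = (λ { {i} {_ , p} refl → trans (irr (e .complete p) (∈-lookup i)) (index-∈-lookup xs i) })
              , (λ { {_ , p} refl → sym (lookup-index (e .complete p)) })
  }
  where
  irr : ∀ {x} (m m′ : x ∈ xs) → index m ≡ index m′
  irr m m′ = cong index (unique⇒irrelevant (e .unique) m m′)
  index-∈-lookup : (ys : List _) (i : Fin (length ys)) → index (∈-lookup {xs = ys} i) ≡ i
  index-∈-lookup (y ∷ ys) zero    = refl
  index-∈-lookup (y ∷ ys) (suc i) = cong suc (index-∈-lookup ys i)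

-- Pronic numbers and a recurrence determined by its initial value.

pronic : ℤ → ℕ
pronic (+ j)    = j ℕ.* suc j
pronic -[1+ j ] = j ℕ.* suc j

+pronic : ∀ k → + pronic k ≡ k * (k + + 1)
+pronic (+ j)    = trans (ℤ.pos-* j (suc j)) (cong (λ i → + j * + i) (ℕ.+-comm 1 j))
+pronic -[1+ j ] = trans (ℤ.pos-* j (suc j)) (lemma (+ j))
  where
  lemma : ∀ i → i * (+ 1 + i) ≡ - (+ 1 + i) * (- (+ 1 + i) + + 1)
  lemma = solve-∀

positivePronicBases : ℕ → List ℕ
positivePronicBases n = filter (λ j → j ℕ.* suc j ℕ.≤? n) (map suc (upTo n))

-- The bases 0 and -1, the only ones with pronic number 0, stand in front so that their terms split
-- off a sum by computation. Every other base is `+ j` or `-[1+ j ]` with j positive, and both of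
-- these have pronic number j(j+1).
pronicBases : ℕ → List ℤ
pronicBases n = + 0 ∷ -[1+ 0 ] ∷ map +_ js ++ map -[1+_] js
  where js = positivePronicBases n

∈-positivePronicBases⁻ : ∀ {n j} → j ∈ positivePronicBases n → 1 ℕ.≤ j × j ℕ.* suc j ℕ.≤ n
∈-positivePronicBases⁻ {n} m with ∈-filter⁻ (λ j → j ℕ.* suc j ℕ.≤? n) {xs = map suc (upTo n)} m
... | m′ , le with ∈-map⁻ suc m′
... | i , _ , refl = s≤s z≤n , le

∈-positivePronicBases⁺ : ∀ {n j} → suc j ℕ.* suc (suc j) ℕ.≤ n → suc j ∈ positivePronicBases n
∈-positivePronicBases⁺ {n} {j} le =
  ∈-filter⁺ _ (∈-map⁺ suc (∈-upTo⁺ (ℕ.≤-trans (ℕ.m≤m*n (suc j) (suc (suc j))) le))) le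

Enum-pronicBases : ∀ n → Enum (λ k → pronic k ℕ.≤ n) (pronicBases n)
Enum-pronicBases n = record { unique = uniq ; sound = snd ; complete = λ {k} → cpl k }
  where
  js = positivePronicBases n
  tail = map +_ js ++ map -[1+_] js
  unique-js : Unique js
  unique-js = Unique.filter⁺ _ (Unique.map⁺ ℕ.suc-injective (Unique.upTo⁺ n))
  tail⁻ : ∀ {k} → k ∈ tail → ∃ λ j → j ∈ js × (k ≡ + j ⊎ k ≡ -[1+ j ])
  tail⁻ m with ∈-++⁻ (map +_ js) m
  ... | inj₁ m′ = let j , j∈ , eq = ∈-map⁻ +_ m′ in j , j∈ , inj₁ eq
  ... | inj₂ m′ = let j , j∈ , eq = ∈-map⁻ -[1+_] m′ in j , j∈ , inj₂ eq
  0∉js : ¬ 0 ∈ js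
  0∉js m with () ← proj₁ (∈-positivePronicBases⁻ {n} m)
  fresh⁺ : ∀ {k} → k ∈ tail → + 0 ≢ k
  fresh⁺ m refl with tail⁻ m
  ... | _ , j∈ , inj₁ refl = 0∉js j∈
  fresh⁻ : ∀ {k} → k ∈ tail → -[1+ 0 ] ≢ k
  fresh⁻ m refl with tail⁻ m
  ... | _ , j∈ , inj₂ refl = 0∉js j∈
  disjoint : ∀ {k} → ¬ (k ∈ map +_ js × k ∈ map -[1+_] js)
  disjoint (m , m′) with ∈-map⁻ +_ m | ∈-map⁻ -[1+_] m′
  ... | _ , _ , refl | _ , _ , ()
  uniq : Unique (pronicBases n)
  uniq = ((λ ()) ∷ All.tabulate fresh⁺) ∷ All.tabulate fresh⁻
       ∷ Unique.++⁺ (Unique.map⁺ ℤ.+-injective unique-js) (Unique.map⁺ ℤ.-[1+-injective unique-js) disjoint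
  snd : ∀ {k} → k ∈ pronicBases n → pronic k ℕ.≤ n
  snd (here refl)         = z≤n
  snd (there (here refl)) = z≤n
  snd (there (there m)) with tail⁻ m
  ... | j , j∈ , inj₁ refl = proj₂ (∈-positivePronicBases⁻ {n} j∈)
  ... | j , j∈ , inj₂ refl = proj₂ (∈-positivePronicBases⁻ {n} j∈)
  cpl : ∀ k → pronic k ℕ.≤ n → k ∈ pronicBases n
  cpl (+ zero)     _  = here refl
  cpl -[1+ zero ]  _  = there (here refl)
  cpl (+ suc j)    le = there (there (∈-++⁺ˡ (∈-map⁺ +_ (∈-positivePronicBases⁺ le))))
  cpl -[1+ suc j ] le = there (there (∈-++⁺ʳ (map +_ js) (∈-map⁺ -[1+_] (∈-positivePronicBases⁺ le))))

-- Let H and ψ be the generating functions of h and of the pronic numbers of all integers, and let θ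
-- = q d/dq. The left side is the coefficient of q^n in ψ·θH - 4·H·θψ, so the recurrence says that H
-- has the logarithmic derivative of ψ^4. The subtraction is never truncated, since `pronic k` is at
-- most n on `pronicBases n`.
PronicRecurrence : (ℕ → ℤ) → Set
PronicRecurrence h =
  ∀ n → ∑ (pronicBases n) (λ k → (+ n - + 5 * + pronic k) * h (n ℕ.∸ pronic k)) ≡ + 0

-- The bases 0 and -1 contribute n·h(n) each; all other terms involve h at smaller arguments and
-- vanish by induction. Hence 2n·h(n) = 0. At n = 0 the recurrence is vacuous, so h(0) = 0 has to be
-- assumed.
pronicRecurrence⇒≡0 : (h : ℕ → ℤ) → PronicRecurrence h → h 0 ≡ + 0 → ∀ n → h n ≡ + 0
pronicRecurrence⇒≡0 h rec h0 = ℕ.<-rec _ step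
  where
  step : ∀ n → (∀ {i} → i ℕ.< n → h i ≡ + 0) → h n ≡ + 0
  step zero      ih = h0
  step n@(suc _) ih = ℤ.*-cancelˡ-≡ (+ 2 * + n) (h n) (+ 0) (begin
    + 2 * + n * h n            ≡⟨ split (+ n) (h n) ⟩
    lead + (lead + + 0)        ≡⟨ +-congˡ lead (+-congˡ lead vanish) ⟨
    ∑ (pronicBases n) term     ≡⟨ rec n ⟩
    + 0                        ≡⟨ ℤ.*-zeroʳ (+ 2 * + n) ⟨
    + 2 * + n * + 0            ∎)
    where
    term : ℤ → ℤ
    term k = (+ n - + 5 * + pronic k) * h (n ℕ.∸ pronic k)
    lead = (+ n - + 5 * + 0) * h n
    js = positivePronicBases n
    split : ∀ i a → + 2 * i * a ≡ (i - + 5 * + 0) * a + ((i - + 5 * + 0) * a + + 0)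
    split = solve-∀
    small : ∀ {j} → j ∈ js → ∀ k → pronic k ≡ j ℕ.* suc j → term k ≡ + 0
    small {j} j∈ k eq = begin
      term k                                       ≡⟨ cong (λ i → (+ n - + 5 * + pronic k) * i) (ih lt) ⟩
      (+ n - + 5 * + pronic k) * + 0               ≡⟨ ℤ.*-zeroʳ (+ n - + 5 * + pronic k) ⟩
      + 0                                          ∎
      where
      lt : n ℕ.∸ pronic k ℕ.< n
      lt with ∈-positivePronicBases⁻ {n} {j} j∈
      -- With j = `suc i` the number `pronic k` is a successor, so the difference from n computes to
      -- a difference from the predecessor of n.
      ... | s≤s {n = i} _ , le rewrite eq = s≤s (ℕ.m∸n≤m (ℕ.pred n) (suc i ℕ.+ i ℕ.* suc (suc i)))
    vanish : ∑ (map +_ js ++ map -[1+_] js) term ≡ + 0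
    vanish = begin
      ∑ (map +_ js ++ map -[1+_] js) term          ≡⟨ ∑-++ term (map +_ js) _ ⟩
      ∑ (map +_ js) term + ∑ (map -[1+_] js) term  ≡⟨ cong₂ _+_ (∑-map term +_ js) (∑-map term -[1+_] js) ⟩
      ∑ js (term ∘ +_) + ∑ js (term ∘ -[1+_])      ≡⟨ cong₂ _+_ (∑-cong js (λ {j} m → small m (+ j) refl))
                                                                (∑-cong js (λ {j} m → small m -[1+ j ] refl)) ⟩
      ∑ js (λ _ → + 0) + ∑ js (λ _ → + 0)          ≡⟨ cong₂ _+_ (∑-zero js) (∑-zero js) ⟩
      + 0                                          ∎

-- Graded sets with finite levels, and their generating functions.

record Graded : Set₁ where
  field
    Carrier : Set
    norm    : Carrier → ℕ
    level   : ℕ → List Carrier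
    enum    : ∀ n → Enum (λ x → norm x ≡ n) (level n)

open Graded

-- This is the coefficient of q^n in the generating function of the norm weighted by `w`.
total : (G : Graded) → (Carrier G → ℤ) → ℕ → ℤ
total G w n = ∑ (level G n) w

∑-concatMap : (f : A → List B) (g : B → ℤ) (xs : List A) → ∑ (concatMap f xs) g ≡ ∑ xs (λ x → ∑ (f x) g)
∑-concatMap f g []       = refl
∑-concatMap f g (x ∷ xs) = trans (∑-++ g (f x) (concatMap f xs)) (+-congˡ (∑ (f x) g) (∑-concatMap f g xs))

fibres : (A → List B) → List A → List (A × B)
fibres f = concatMap (λ x → map (x ,_) (f x))

∈-fibres⁻ : (f : A → List B) (xs : List A) {a : A} {b : B} → (a , b) ∈ fibres f xs → a ∈ xs × b ∈ f a
∈-fibres⁻ f (x ∷ xs) m with ∈-++⁻ (map (x ,_) (f x)) m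
... | inj₂ m′ = let a∈ , b∈ = ∈-fibres⁻ f xs m′ in there a∈ , b∈
... | inj₁ m′ with ∈-map⁻ (x ,_) m′
... | _ , b∈ , refl = here refl , b∈

∈-fibres⁺ : (f : A → List B) {xs : List A} {a : A} {b : B} → a ∈ xs → b ∈ f a → (a , b) ∈ fibres f xs
∈-fibres⁺ f (here refl) b∈ = ∈-++⁺ˡ (∈-map⁺ _ b∈)
∈-fibres⁺ f {xs = x ∷ _} (there a∈) b∈ = ∈-++⁺ʳ (map (x ,_) (f x)) (∈-fibres⁺ f a∈ b∈)

unique-fibres : (f : A → List B) {xs : List A} → (∀ x → Unique (f x)) → Unique xs → Unique (fibres f xs)
unique-fibres f uf [] = []
unique-fibres f {xs = x ∷ xs} uf (x∉ ∷ u) =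
  Unique.++⁺ (Unique.map⁺ (λ { refl → refl }) (uf x)) (unique-fibres f uf u) disjoint
  where
  disjoint : ∀ {p} → ¬ (p ∈ map (x ,_) (f x) × p ∈ fibres f xs)
  disjoint (m , m′) with ∈-map⁻ (x ,_) m
  ... | _ , _ , refl = All.lookup x∉ (proj₁ (∈-fibres⁻ f xs m′)) refl

infixr 6 ℤ⊗_

-- Adjoining an integer coordinate multiplies the generating function by ψ, the sum of q^(k(k+1))
-- over all integers k.
ℤ⊗_ : Graded → Graded
(ℤ⊗ G) .Carrier        = ℤ × Carrier G
(ℤ⊗ G) .norm (k , x)   = pronic k ℕ.+ norm G x
(ℤ⊗ G) .level n        = fibres (λ k → level G (n ℕ.∸ pronic k)) (pronicBases n)
(ℤ⊗ G) .enum n .unique =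
  unique-fibres _ (λ k → enum G (n ℕ.∸ pronic k) .unique) (Enum-pronicBases n .unique)
(ℤ⊗ G) .enum n .sound {k , x} m =
  let k∈ , x∈ = ∈-fibres⁻ (λ k → level G (n ℕ.∸ pronic k)) (pronicBases n) m
  in trans (cong (pronic k ℕ.+_) (enum G _ .sound x∈)) (ℕ.m+[n∸m]≡n (Enum-pronicBases n .sound k∈))
(ℤ⊗ G) .enum n .complete {k , x} refl =
  ∈-fibres⁺ (λ k → level G (n ℕ.∸ pronic k)) (Enum-pronicBases n .complete (ℕ.m≤m+n (pronic k) (norm G x)))
            (enum G _ .complete (sym (ℕ.m+n∸m≡n (pronic k) (norm G x))))

-- A weight that is a product factors on the fibre over each k, which gives the Cauchy product. Read
-- from right to left, it turns the left side of the recurrence into one sum over a level of `ℤ⊗ G`.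
total-ℤ⊗ : (G : Graded) (c : ℤ → ℤ) (w : Carrier G → ℤ) (n : ℕ) →
           total (ℤ⊗ G) (λ (k , x) → c k * w x) n ≡ ∑ (pronicBases n) (λ k → c k * total G w (n ℕ.∸ pronic k))
total-ℤ⊗ G c w n = trans
  (∑-concatMap (λ k → map (k ,_) (level G (n ℕ.∸ pronic k))) _ (pronicBases n))
  (∑-cong (pronicBases n) (λ {k} _ → trans
    (∑-map _ (k ,_) (level G (n ℕ.∸ pronic k)))
    (∑-*ˡ (c k) w (level G (n ℕ.∸ pronic k)))))

unit : Graded
unit .Carrier       = ⊤
unit .norm _        = 0
unit .level zero    = tt ∷ []
unit .level (suc _) = []
unit .enum zero .unique     = [] ∷ []
unit .enum zero .sound _    = refl
unit .enum zero .complete _ = here refl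
unit .enum (suc _) .unique  = []

-- Sums of four pronic numbers.

quadruples : Graded
quadruples = ℤ⊗ ℤ⊗ ℤ⊗ ℤ⊗ unit

-- On quintuples whose pronic numbers add up to n, the weight n - 5p(k) is the sum of the four
-- differences p(x) - p(k), with x one of the other coordinates. Each difference changes sign when k
-- and x are exchanged, so each sums to zero.
quadruples-recurrence : PronicRecurrence (total quadruples (λ _ → + 1))
quadruples-recurrence n = begin
  ∑ (pronicBases n) (λ k → c k * total quadruples (λ _ → + 1) (n ℕ.∸ pronic k))
    ≡⟨ total-ℤ⊗ quadruples c (λ _ → + 1) n ⟨
  ∑ R (λ (k , _) → c k * + 1)
    ≡⟨ ∑-cong R (λ {x} m → expand {x} (e .sound m)) ⟩
  ∑ R (λ x → d₁ x + (d₂ x + (d₃ x + d₄ x)))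
    ≡⟨ trans (∑-+ d₁ _ R) (cong₂ _+_ s₁
        (trans (∑-+ d₂ _ R) (cong₂ _+_ s₂ (trans (∑-+ d₃ d₄ R) (cong₂ _+_ s₃ s₄))))) ⟩
  + 0 ∎
  where
  T = Carrier (ℤ⊗ quadruples)
  R = level (ℤ⊗ quadruples) n
  e = enum (ℤ⊗ quadruples) n
  c : ℤ → ℤ
  c k = + n - + 5 * + pronic k
  d₁ d₂ d₃ d₄ : T → ℤ
  d₁ (k , x , y , z , w , _) = + pronic x - + pronic k
  d₂ (k , x , y , z , w , _) = + pronic y - + pronic k
  d₃ (k , x , y , z , w , _) = + pronic z - + pronic k
  d₄ (k , x , y , z , w , _) = + pronic w - + pronic k
  expand : ∀ {v} → norm (ℤ⊗ quadruples) v ≡ n → c (proj₁ v) * + 1 ≡ d₁ v + (d₂ v + (d₃ v + d₄ v))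
  expand {k , x , y , z , w , _} refl = trans
    (cong (λ i → (i - + 5 * + pronic k) * + 1) (trans (ℤ.pos-+ (pronic k) _) (+-congˡ (+ pronic k)
      (trans (ℤ.pos-+ (pronic x) _) (+-congˡ (+ pronic x) (trans (ℤ.pos-+ (pronic y) _)
      (+-congˡ (+ pronic y) (trans (ℤ.pos-+ (pronic z) _) (+-congˡ (+ pronic z) (ℤ.pos-+ (pronic w) 0))))))))))
    (poly (+ pronic k) (+ pronic x) (+ pronic y) (+ pronic z) (+ pronic w))
    where
    poly : ∀ p a b c d → (p + (a + (b + (c + (d + + 0)))) - + 5 * p) * + 1 ≡ a - p + (b - p + (c - p + (d - p)))
    poly = solve-∀
  antisym : ∀ i j → i - j ≡ - (j - i)
  antisym = solve-∀
  s₁ : ∑ R d₁ ≡ + 0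
  s₁ = ∑-antisymmetric (λ { (k , x , y , z , w , _) → x , k , y , z , w , tt })
    (λ {(k , x , y , z , w , _)} → trans (perm (pronic x) (pronic k) _)) (λ _ → refl) e d₁
    (λ {(k , x , _)} _ → antisym (+ pronic k) (+ pronic x))
    where
    perm : ∀ p a b → p ℕ.+ (a ℕ.+ b) ≡ a ℕ.+ (p ℕ.+ b)
    perm = ℕSolver.solve-∀
  s₂ : ∑ R d₂ ≡ + 0
  s₂ = ∑-antisymmetric (λ { (k , x , y , z , w , _) → y , x , k , z , w , tt })
    (λ {(k , x , y , z , w , _)} → trans (perm (pronic y) (pronic x) (pronic k) _)) (λ _ → refl) e d₂
    (λ {(k , x , y , _)} _ → antisym (+ pronic k) (+ pronic y))
    where
    perm : ∀ p a b c → p ℕ.+ (a ℕ.+ (b ℕ.+ c)) ≡ b ℕ.+ (a ℕ.+ (p ℕ.+ c))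
    perm = ℕSolver.solve-∀
  s₃ : ∑ R d₃ ≡ + 0
  s₃ = ∑-antisymmetric (λ { (k , x , y , z , w , _) → z , x , y , k , w , tt })
    (λ {(k , x , y , z , w , _)} → trans (perm (pronic z) (pronic x) (pronic y) (pronic k) _)) (λ _ → refl) e d₃
    (λ {(k , x , y , z , _)} _ → antisym (+ pronic k) (+ pronic z))
    where
    perm : ∀ p a b c d → p ℕ.+ (a ℕ.+ (b ℕ.+ (c ℕ.+ d))) ≡ c ℕ.+ (a ℕ.+ (b ℕ.+ (p ℕ.+ d)))
    perm = ℕSolver.solve-∀
  s₄ : ∑ R d₄ ≡ + 0
  s₄ = ∑-antisymmetric (λ { (k , x , y , z , w , _) → w , x , y , z , k , tt })
    (λ {(k , x , y , z , w , _)} → trans (perm (pronic w) (pronic x) (pronic y) (pronic z) (pronic k) 0)) (λ _ → refl) e d₄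
    (λ {(k , x , y , z , w , _)} _ → antisym (+ pronic k) (+ pronic w))
    where
    perm : ∀ p a b c d f → p ℕ.+ (a ℕ.+ (b ℕ.+ (c ℕ.+ (d ℕ.+ f)))) ≡ d ℕ.+ (a ℕ.+ (b ℕ.+ (c ℕ.+ (p ℕ.+ f))))
    perm = ℕSolver.solve-∀

-- Factorisations into two odd factors, and their recurrence.

oddFactorisations : Graded
oddFactorisations = record
  { Carrier = ℕ × ℕ
  ; norm    = form
  ; level   = λ n → filter (form? n) (square n)
  ; enum    = λ n → record
    { unique   = Unique.filter⁺ (form? n) (Unique.cartesianProduct⁺ (Unique.upTo⁺ (suc n)) (Unique.upTo⁺ (suc n)))
    ; sound    = λ m → proj₂ (∈-filter⁻ (form? n) {xs = square n} m)
    ; complete = λ { {a , b} refl → ∈-filter⁺ (form? n)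
        (∈-cartesianProduct⁺ (∈-upTo⁺ (s≤s (a≤form a b))) (∈-upTo⁺ (s≤s (b≤form a b)))) refl }
    }
  }
  where
  -- The value n of the form means (2a+1)(2b+1) = n+1. Neither a nor b exceeds this value, so a
  -- search over the square up to n finds all pairs.
  form : ℕ × ℕ → ℕ
  form (a , b) = 4 ℕ.* (a ℕ.* b) ℕ.+ 2 ℕ.* a ℕ.+ 2 ℕ.* b
  form? : ∀ n → Decidable (λ x → form x ≡ n)
  form? n x = form x ℕ.≟ n
  square : ℕ → List (ℕ × ℕ)
  square n = cartesianProduct (upTo (suc n)) (upTo (suc n))
  a≤form : ∀ a b → a ℕ.≤ form (a , b)
  a≤form a b = ℕ.≤-trans (ℕ.≤-trans (ℕ.m≤n*m a 2) (ℕ.m≤n+m (2 ℕ.* a) (4 ℕ.* (a ℕ.* b)))) (ℕ.m≤m+n _ (2 ℕ.* b))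
  b≤form : ∀ a b → b ℕ.≤ form (a , b)
  b≤form a b = ℕ.≤-trans (ℕ.m≤n*m b 2) (ℕ.m≤n+m (2 ℕ.* b) (4 ℕ.* (a ℕ.* b) ℕ.+ 2 ℕ.* a))

odd : ℤ → ℤ
odd i = + 1 + + 2 * i

firstFactor : ℕ × ℕ → ℤ
firstFactor (a , _) = odd (+ a)

module _ (n : ℕ) where
  private
    T = ℤ × ℕ × ℕ
    S = ℤ⊗ oddFactorisations

    InS : T → Set
    InS x = norm S x ≡ n

    -- With x = 2k+1, d = 2a+1 and δ = 2b+1, four times this value plus 5 is x² + 4dδ.
    quad : ℤ → ℤ → ℤ → ℤ
    quad k a b = k * (k + + 1) + (+ 4 * (a * b) + + 2 * a + + 2 * b)

    norm≡quad : ∀ k a b → + norm S (k , a , b) ≡ quad k (+ a) (+ b)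
    norm≡quad k a b = trans (ℤ.pos-+ (pronic k) _) (cong₂ _+_ (+pronic k)
      (trans (ℤ.pos-+ (4 ℕ.* (a ℕ.* b) ℕ.+ 2 ℕ.* a) _) (cong₂ _+_
        (trans (ℤ.pos-+ (4 ℕ.* (a ℕ.* b)) _)
          (cong₂ _+_ (trans (ℤ.pos-* 4 (a ℕ.* b)) (cong (+ 4 *_) (ℤ.pos-* a b))) (ℤ.pos-* 2 a)))
        (ℤ.pos-* 2 b))))

    transport : ∀ {k a b} k′ a′ b′ → quad k′ (+ a′) (+ b′) ≡ quad k (+ a) (+ b) →
                InS (k , a , b) → InS (k′ , a′ , b′)
    transport {k} {a} {b} k′ a′ b′ eq s = trans
      (ℤ.+-injective (trans (norm≡quad k′ a′ b′) (trans eq (sym (norm≡quad k a b))))) s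

    -- With x = 2k+1, d = 2a+1 and δ = 2b+1, this is (δ − x − d − 1)/2.
    excess : T → ℤ
    excess (k , a , b) = + b - + a - k - + 1

    Upper : T → Set
    Upper x = + 0 ℤ.≤ excess x

    upper? : Decidable Upper
    upper? x = + 0 ℤ.≤? excess x

    u : T → ℤ
    u (k , a , b) = (odd (+ a) + odd (+ b)) * (odd (+ b) - odd k) * (odd (+ a) + odd k)

    -- This is (x,d,δ) ↦ (-x-2d, d, δ-x-d) in the coordinates k, a, b: the new b is exactly
    -- `excess x`. The absolute value only brings it back to ℕ and changes nothing on `Upper`.
    φ : T → T
    φ x@(k , a , _) = - k - + 2 * + a - + 2 , a , ∣ excess x ∣

    -- On `Upper`, φ exchanges b with the excess. Both the invariance of `Upper` and the involution
    -- property follow from this.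
    upper-φ : ∀ x → Upper x → excess (φ x) ≡ + proj₂ (proj₂ x)
    upper-φ x@(k , a , b) up = trans
      (cong (λ i → i - + a - (- k - + 2 * + a - + 2) - + 1) (ℤ.0≤i⇒+∣i∣≡i up)) (poly k (+ a) (+ b))
      where
      poly : ∀ k a b → (b - a - k - + 1) - a - (- k - + 2 * a - + 2) - + 1 ≡ b
      poly = solve-∀

    φ-into : ∀ {x} → InS x × Upper x → InS (φ x) × Upper (φ x)
    φ-into {x@(k , a , b)} (s , up) =
      transport {k} {a} {b} (- k - + 2 * + a - + 2) a ∣ excess x ∣
        (trans (cong (quad (- k - + 2 * + a - + 2) (+ a)) (ℤ.0≤i⇒+∣i∣≡i up)) (poly k (+ a) (+ b))) s
      , subst (+ 0 ℤ.≤_) (sym (upper-φ x up)) (ℤ.+≤+ z≤n)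
      where
      poly : ∀ k a b →
        (- k - + 2 * a - + 2) * ((- k - + 2 * a - + 2) + + 1)
          + (+ 4 * (a * (b - a - k - + 1)) + + 2 * a + + 2 * (b - a - k - + 1))
        ≡ k * (k + + 1) + (+ 4 * (a * b) + + 2 * a + + 2 * b)
      poly = solve-∀

    φ-involutive : ∀ {x} → InS x × Upper x → φ (φ x) ≡ x
    φ-involutive {x@(k , a , b)} (_ , up) = cong₂ (λ k b → k , a , b) (poly k (+ a)) (cong ∣_∣ (upper-φ x up))
      where
      poly : ∀ k a → - (- k - + 2 * a - + 2) - + 2 * a - + 2 ≡ k
      poly = solve-∀

    -- Under φ the factors d+δ and δ-x of `u` change places, while d+x becomes its negative.
    φ-anti : ∀ {x} → InS x × Upper x → u (φ x) ≡ - u x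
    φ-anti {x@(k , a , b)} (_ , up) = trans
      (cong (λ i → (odd (+ a) + odd i) * (odd i - odd (- k - + 2 * + a - + 2)) * (odd (+ a) + odd (- k - + 2 * + a - + 2)))
        (ℤ.0≤i⇒+∣i∣≡i up))
      (poly k (+ a) (+ b))
      where
      poly : ∀ k a b →
        ((+ 1 + + 2 * a) + (+ 1 + + 2 * (b - a - k - + 1)))
          * ((+ 1 + + 2 * (b - a - k - + 1)) - (+ 1 + + 2 * (- k - + 2 * a - + 2)))
          * ((+ 1 + + 2 * a) + (+ 1 + + 2 * (- k - + 2 * a - + 2)))
        ≡ - (((+ 1 + + 2 * a) + (+ 1 + + 2 * b)) * ((+ 1 + + 2 * b) - (+ 1 + + 2 * k)) * ((+ 1 + + 2 * a) + (+ 1 + + 2 * k)))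
      poly = solve-∀

    flip swap ρ : T → T
    flip (k , a , b) = - + 1 - k , a , b
    swap (k , a , b) = k , b , a
    ρ x = flip (swap x)

    flip-into : ∀ {x} → InS x → InS (flip x)
    flip-into {k , a , b} = transport {k} {a} {b} (- + 1 - k) a b (poly k (+ a) (+ b))
      where
      poly : ∀ k a b → (- + 1 - k) * ((- + 1 - k) + + 1) + (+ 4 * (a * b) + + 2 * a + + 2 * b)
             ≡ k * (k + + 1) + (+ 4 * (a * b) + + 2 * a + + 2 * b)
      poly = solve-∀

    swap-into : ∀ {x} → InS x → InS (swap x)
    swap-into {k , a , b} = transport {k} {a} {b} k b a (poly k (+ a) (+ b))
      where
      poly : ∀ k a b → k * (k + + 1) + (+ 4 * (b * a) + + 2 * b + + 2 * a)
             ≡ k * (k + + 1) + (+ 4 * (a * b) + + 2 * a + + 2 * b)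
      poly = solve-∀

    flip-involutive : ∀ x → flip (flip x) ≡ x
    flip-involutive (k , a , b) = cong (_, a , b) (poly k)
      where
      poly : ∀ k → - + 1 - (- + 1 - k) ≡ k
      poly = solve-∀

    -- Of the integers i and -1-i exactly one is nonnegative, so `ρ` exchanges `Upper` with its
    -- complement.
    excess-ρ : ∀ x → excess (ρ x) ≡ - + 1 - excess x
    excess-ρ (k , a , b) = poly k (+ a) (+ b)
      where
      poly : ∀ k a b → a - b - (- + 1 - k) - + 1 ≡ - + 1 - (b - a - k - + 1)
      poly = solve-∀

    nonneg⇒neg : ∀ i → + 0 ℤ.≤ i → ¬ + 0 ℤ.≤ - + 1 - i
    nonneg⇒neg (+ zero)  _ ()
    nonneg⇒neg (+ suc _) _ ()

    neg⇒nonneg : ∀ i → ¬ + 0 ℤ.≤ i → + 0 ℤ.≤ - + 1 - i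
    neg⇒nonneg (+ _)    neg = ⊥-elim (neg (ℤ.+≤+ z≤n))
    neg⇒nonneg -[1+ _ ] neg = ℤ.+≤+ z≤n

    ρ-into : ∀ {x} → InS x → InS (ρ x)
    ρ-into {x} s = flip-into {swap x} (swap-into {x} s)

    ρ-upper : ∀ {x} → Upper x → ¬ Upper (ρ x)
    ρ-upper {x} up up′ = nonneg⇒neg (excess x) up (subst (+ 0 ℤ.≤_) (excess-ρ x) up′)

    ρ-lower : ∀ {x} → ¬ Upper x → Upper (ρ x)
    ρ-lower {x} low = subst (+ 0 ℤ.≤_) (sym (excess-ρ x)) (neg⇒nonneg (excess x) low)

    -- Under (x,d,δ) ↦ (-x,δ,d) the factors δ-x and d+x of `u` change places.
    u-ρ : ∀ x → u (ρ x) ≡ u x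
    u-ρ (k , a , b) = poly k (+ a) (+ b)
      where
      poly : ∀ k a b →
        ((+ 1 + + 2 * b) + (+ 1 + + 2 * a)) * ((+ 1 + + 2 * a) - (+ 1 + + 2 * (- + 1 - k))) * ((+ 1 + + 2 * b) + (+ 1 + + 2 * (- + 1 - k)))
        ≡ ((+ 1 + + 2 * a) + (+ 1 + + 2 * b)) * ((+ 1 + + 2 * b) - (+ 1 + + 2 * k)) * ((+ 1 + + 2 * a) + (+ 1 + + 2 * k))
      poly = solve-∀

    R = level S n
    e = enum S n

    ∑u≡0 : ∑ R u ≡ + 0
    ∑u≡0 = trans
      (∑-halve upper? ρ (λ {x} → ρ-into {x}) flip-involutive (λ {x} → ρ-upper {x}) (λ {x} → ρ-lower {x}) e u u-ρ)
      (cong (+ 2 *_) (∑-antisymmetric φ (λ {x} → φ-into {x}) (λ {x} → φ-involutive {x})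
                        (Enum-filter upper? e) u (λ {x} → φ-anti {x})))

    g : T → ℤ
    g (k , a , b) = (odd (+ a) * odd (+ b) - odd k * odd k) * odd (+ a)

    -- Expanding, u = (d+δ)(dδ - x² + x(δ-d)). Adding the value at -x removes the part odd in x, and
    -- (d+δ)(dδ-x²) is the symmetrisation of `g` in d and δ.
    u+u-flip : ∀ x → u x + u (flip x) ≡ + 2 * (g x + g (swap x))
    u+u-flip (k , a , b) = poly k (+ a) (+ b)
      where
      poly : ∀ k a b →
        ((+ 1 + + 2 * a) + (+ 1 + + 2 * b)) * ((+ 1 + + 2 * b) - (+ 1 + + 2 * k)) * ((+ 1 + + 2 * a) + (+ 1 + + 2 * k))
        + ((+ 1 + + 2 * a) + (+ 1 + + 2 * b)) * ((+ 1 + + 2 * b) - (+ 1 + + 2 * (- + 1 - k))) * ((+ 1 + + 2 * a) + (+ 1 + + 2 * (- + 1 - k)))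
        ≡ + 2 * (((+ 1 + + 2 * a) * (+ 1 + + 2 * b) - (+ 1 + + 2 * k) * (+ 1 + + 2 * k)) * (+ 1 + + 2 * a)
               + ((+ 1 + + 2 * b) * (+ 1 + + 2 * a) - (+ 1 + + 2 * k) * (+ 1 + + 2 * k)) * (+ 1 + + 2 * b))
      poly = solve-∀

    ∑g≡0 : ∑ R g ≡ + 0
    ∑g≡0 = ℤ.*-cancelˡ-≡ (+ 4) (∑ R g) (+ 0) (begin
      + 4 * ∑ R g                          ≡⟨ four (∑ R g) ⟩
      + 2 * (∑ R g + ∑ R g)                ≡⟨ cong (λ s → + 2 * (∑ R g + s)) ∑-swap ⟩
      + 2 * (∑ R g + ∑ R (g ∘ swap))       ≡⟨ cong (+ 2 *_) (∑-+ g (g ∘ swap) R) ⟨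
      + 2 * ∑ R (λ x → g x + g (swap x))   ≡⟨ ∑-*ˡ (+ 2) _ R ⟨
      ∑ R (λ x → + 2 * (g x + g (swap x))) ≡⟨ ∑-cong R (λ {x} _ → u+u-flip x) ⟨
      ∑ R (λ x → u x + u (flip x))         ≡⟨ ∑-+ u (u ∘ flip) R ⟩
      ∑ R u + ∑ R (u ∘ flip)               ≡⟨ cong₂ _+_ ∑u≡0 (trans (sym ∑-flip) ∑u≡0) ⟩
      + 0                                  ∎)
      where
      four : ∀ i → + 4 * i ≡ + 2 * (i + i)
      four = solve-∀
      ∑-swap : ∑ R g ≡ ∑ R (g ∘ swap)
      ∑-swap = ∑-inverse swap swap (λ {x} → swap-into {x}) (λ {x} → swap-into {x}) (λ _ → refl) (λ _ → refl) e e g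
      ∑-flip : ∑ R u ≡ ∑ R (u ∘ flip)
      ∑-flip = ∑-inverse flip flip (λ {x} → flip-into {x}) (λ {x} → flip-into {x})
                         (λ {x} _ → flip-involutive x) (λ {x} _ → flip-involutive x) e e u

  -- On triples with x² + 4dδ = 4n+5 and x = 2k+1, the coefficient n - 5p(k) equals dδ - x², so the
  -- summand is `g`.
  oddFactorisations-recurrence :
    ∑ (pronicBases n) (λ k → (+ n - + 5 * + pronic k) * total oddFactorisations firstFactor (n ℕ.∸ pronic k)) ≡ + 0
  oddFactorisations-recurrence = begin
    ∑ (pronicBases n) (λ k → c k * total oddFactorisations firstFactor (n ℕ.∸ pronic k))
      ≡⟨ total-ℤ⊗ oddFactorisations c firstFactor n ⟨
    ∑ R (λ (k , x) → c k * firstFactor x)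
      ≡⟨ ∑-cong R (λ {x} m → expand {x} (e .sound m)) ⟩
    ∑ R g
      ≡⟨ ∑g≡0 ⟩
    + 0 ∎
    where
    c : ℤ → ℤ
    c k = + n - + 5 * + pronic k
    expand : ∀ {x} → InS x → c (proj₁ x) * firstFactor (proj₂ x) ≡ g x
    expand {k , a , b} s = trans
      (cong₂ (λ i j → (i - + 5 * j) * odd (+ a)) (trans (cong +_ (sym s)) (norm≡quad k a b)) (+pronic k))
      (poly k (+ a) (+ b))
      where
      poly : ∀ k a b →
        (k * (k + + 1) + (+ 4 * (a * b) + + 2 * a + + 2 * b) - + 5 * (k * (k + + 1))) * (+ 1 + + 2 * a)
        ≡ ((+ 1 + + 2 * a) * (+ 1 + + 2 * b) - (+ 1 + + 2 * k) * (+ 1 + + 2 * k)) * (+ 1 + + 2 * a)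
      poly = solve-∀

-- Comparison of the two solutions of the recurrence.

count-quadruples : ∀ n → + length (level quadruples n) ≡ + 16 * total oddFactorisations firstFactor n
count-quadruples n = trans (sym (∑-one (level quadruples n)))
  -- The `refl` evaluates h(0): there are 16 quadruples with entries 0 or -1, against 16 times the
  -- weight 1 of the single factorisation 1·1.
  (ℤ.i-j≡0⇒i≡j _ _ (pronicRecurrence⇒≡0 h rec refl n))
  where
  f₁ f₂ h : ℕ → ℤ
  f₁ = total quadruples (λ _ → + 1)
  f₂ = total oddFactorisations firstFactor
  h n = f₁ n - + 16 * f₂ n
  rec : PronicRecurrence h
  rec n = begin
    ∑ K (λ k → c k * h (r k))                                     ≡⟨ ∑-cong K (λ {k} _ → poly (c k) (f₁ (r k)) (f₂ (r k))) ⟩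
    ∑ K (λ k → c k * f₁ (r k) + (- + 16) * (c k * f₂ (r k)))      ≡⟨ ∑-+ (λ k → c k * f₁ (r k)) _ K ⟩
    ∑ K (λ k → c k * f₁ (r k)) + ∑ K (λ k → (- + 16) * (c k * f₂ (r k)))
      ≡⟨ cong₂ _+_ (quadruples-recurrence n) (trans (∑-*ˡ (- + 16) (λ k → c k * f₂ (r k)) K) (cong (- + 16 *_) (oddFactorisations-recurrence n))) ⟩
    + 0 ∎
    where
    K = pronicBases n
    c : ℤ → ℤ
    c k = + n - + 5 * + pronic k
    r : ℤ → ℕ
    r k = n ℕ.∸ pronic k
    poly : ∀ a b d → a * (b - + 16 * d) ≡ a * b + (- + 16) * (a * d)
    poly = solve-∀

-- Parity of integers, and the divisor sum of an odd number.

parityℕ : ∀ n → (∃ λ h → n ≡ 2 ℕ.* h) ⊎ (∃ λ h → n ≡ suc (2 ℕ.* h))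
parityℕ zero = inj₁ (0 , refl)
parityℕ (suc n) with parityℕ n
... | inj₁ (h , refl) = inj₂ (h , refl)
... | inj₂ (h , refl) = inj₁ (suc h , sym (ℕ.*-suc 2 h))

parity : ∀ i → (∃ λ h → i ≡ + 2 * h) ⊎ (∃ λ h → i ≡ odd h)
parity (+ n) with parityℕ n
... | inj₁ (h , refl) = inj₁ (+ h , ℤ.pos-* 2 h)
... | inj₂ (h , refl) = inj₂ (+ h , cong (λ i → + 1 + i) (ℤ.pos-* 2 h))
parity -[1+ n ] with parity (+ n)
... | inj₁ (h , eq) = inj₂ (- h - + 1 , trans (cong (λ i → - (+ 1 + i)) eq) (poly h))
  where
  poly : ∀ h → - (+ 1 + + 2 * h) ≡ + 1 + + 2 * (- h - + 1)
  poly = solve-∀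
... | inj₂ (h , eq) = inj₁ (- h - + 1 , trans (cong (λ i → - (+ 1 + i)) eq) (poly h))
  where
  poly : ∀ h → - (+ 1 + (+ 1 + + 2 * h)) ≡ + 2 * (- h - + 1)
  poly = solve-∀

even-2* : ∀ {i} h → i ≡ + 2 * h → Even i
even-2* h eq = ∣⇒∣ᵤ (divides h (trans eq (ℤ.*-comm (+ 2) h)))

odd-odd : ∀ {i} h → i ≡ odd h → Odd i
odd-odd h refl ev
  with () ← ℕ.∣1⇒≡1 (∣⇒∣ᵤ (∣m+n∣m⇒∣n {m = + 2 * h} (subst (+ 2 Signed.∣_) (ℤ.+-comm (+ 1) (+ 2 * h)) (∣ᵤ⇒∣ ev))
                                    (∣ᵤ⇒∣ (even-2* h refl))))

even⇒2* : ∀ i → Even i → ∃ λ h → i ≡ + 2 * h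
even⇒2* i ev with parity i
... | inj₁ p        = p
... | inj₂ (h , eq) = ⊥-elim (odd-odd h eq ev)

odd⇒odd : ∀ i → Odd i → ∃ λ h → i ≡ odd h
odd⇒odd i od with parity i
... | inj₁ (h , eq) = ⊥-elim (od (even-2* h eq))
... | inj₂ p        = p

even? : Decidable Even
even? i = 2 ℕ.∣? ∣ i ∣

divisors : ℕ → List ℕ
divisors m = filter (ℕ._∣? m) (map suc (upTo m))

Enum-divisors : ∀ n → Enum (ℕ._∣ suc n) (divisors (suc n))
Enum-divisors n = record
  { unique   = Unique.filter⁺ (ℕ._∣? suc n) (Unique.map⁺ ℕ.suc-injective (Unique.upTo⁺ (suc n)))
  ; sound    = λ m → proj₂ (∈-filter⁻ (ℕ._∣? suc n) {xs = map suc (upTo (suc n))} m)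
  ; complete = complete′
  }
  where
  complete′ : ∀ {d} → d ℕ.∣ suc n → d ∈ divisors (suc n)
  complete′ {zero} 0∣ with () ← ℕ.0∣⇒≡0 0∣
  complete′ {suc d} d∣ = ∈-filter⁺ (ℕ._∣? suc n) (∈-map⁺ suc (∈-upTo⁺ (ℕ.∣⇒≤ d∣))) d∣

∑-sum : (ns : List ℕ) → ∑ ns (+_) ≡ + sum ns
∑-sum []       = refl
∑-sum (n ∷ ns) = trans (+-congˡ (+ n) (∑-sum ns)) (sym (ℤ.pos-+ n (sum ns)))

-- A divisor of an odd number and its cofactor are both odd, so (a,b) ↦ 2a+1 is a bijection from the
-- factorisations to the divisors, and the weight is the divisor itself.
total-oddFactorisations : ∀ n → Odd (+ suc n) → total oddFactorisations firstFactor n ≡ + σ (suc n)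
total-oddFactorisations n 2∤m = begin
  total oddFactorisations firstFactor n
    ≡⟨ ∑-cong (level oddFactorisations n) (λ {x} _ → cong (λ i → + 1 + i) (sym (ℤ.pos-* 2 (proj₁ x)))) ⟩
  total oddFactorisations (λ x → + f x) n
    ≡⟨ ∑-reindex f (λ {x} → into {x}) (λ {x} {y} → injective {x} {y}) onto
         (enum oddFactorisations n) (Enum-divisors n) (+_) ⟨
  ∑ (divisors (suc n)) (+_)
    ≡⟨ ∑-sum (divisors (suc n)) ⟩
  + σ (suc n) ∎
  where
  f : ℕ × ℕ → ℕ
  f (a , _) = suc (2 ℕ.* a)
  factor : ∀ a b → suc (norm oddFactorisations (a , b)) ≡ suc (2 ℕ.* b) ℕ.* suc (2 ℕ.* a)
  factor a b = poly a b
    where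
    poly : ∀ a b → 1 ℕ.+ (4 ℕ.* (a ℕ.* b) ℕ.+ 2 ℕ.* a ℕ.+ 2 ℕ.* b) ≡ (1 ℕ.+ 2 ℕ.* b) ℕ.* (1 ℕ.+ 2 ℕ.* a)
    poly = ℕSolver.solve-∀
  into : ∀ {x} → norm oddFactorisations x ≡ n → f x ℕ.∣ suc n
  into {a , b} refl = ℕ.divides (suc (2 ℕ.* b)) (factor a b)
  halve : ∀ {a a′} → suc (2 ℕ.* a) ≡ suc (2 ℕ.* a′) → a ≡ a′
  halve {a} {a′} eq = ℕ.*-cancelˡ-≡ a a′ 2 (ℕ.suc-injective eq)
  injective : ∀ {x y} → norm oddFactorisations x ≡ n → norm oddFactorisations y ≡ n → f x ≡ f y → x ≡ y
  injective {a , b} {a′ , b′} p q eq with refl ← halve {a} {a′} eq =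
    cong (a ,_) (halve (ℕ.*-cancelʳ-≡ _ _ (suc (2 ℕ.* a))
      (trans (sym (factor a b)) (trans (cong suc (trans p (sym q))) (factor a b′)))))
  onto : ∀ {d} → d ℕ.∣ suc n → ∃ λ x → norm oddFactorisations x ≡ n × d ≡ f x
  onto {d} d∣m@(ℕ.divides q eq) with parityℕ d | parityℕ q
  ... | inj₁ (h , refl) | _ = ⊥-elim (2∤m (ℕ.∣-trans (ℕ.m∣m*n h) d∣m))
  ... | inj₂ _ | inj₁ (h , refl) = ⊥-elim (2∤m (ℕ.∣-trans (ℕ.m∣m*n h) (subst (2 ℕ.* h ℕ.∣_) (sym eq) (ℕ.m∣m*n d))))
  ... | inj₂ (a , refl) | inj₂ (b , refl) =
    (a , b) , ℕ.suc-injective (trans (factor a b) (sym eq)) , refl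

length-quadruples : ∀ n → Odd (+ suc n) → length (level quadruples n) ≡ 16 ℕ.* σ (suc n)
length-quadruples n od = ℤ.+-injective (trans (count-quadruples n)
  (trans (cong (+ 16 *_) (total-oddFactorisations n od)) (sym (ℤ.pos-* 16 (σ (suc n))))))

-- Tools for the linear substitutions.

X : Set
X = Carrier quadruples

pronicSum : ℤ → ℤ → ℤ → ℤ → ℤ
pronicSum i j k l = i * (i + + 1) + (j * (j + + 1) + (k * (k + + 1) + l * (l + + 1)))

norm≡pronicSum : ∀ i j k l → + norm quadruples (i , j , k , l , tt) ≡ pronicSum i j k l
norm≡pronicSum i j k l = begin
  + (pronic i ℕ.+ (pronic j ℕ.+ (pronic k ℕ.+ (pronic l ℕ.+ 0))))
    ≡⟨ cong (λ s → + (pronic i ℕ.+ (pronic j ℕ.+ (pronic k ℕ.+ s)))) (ℕ.+-identityʳ (pronic l)) ⟩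
  + (pronic i ℕ.+ (pronic j ℕ.+ (pronic k ℕ.+ pronic l)))
    ≡⟨ trans (ℤ.pos-+ (pronic i) _) (cong₂ _+_ (+pronic i)
         (trans (ℤ.pos-+ (pronic j) _) (cong₂ _+_ (+pronic j)
           (trans (ℤ.pos-+ (pronic k) _) (cong₂ _+_ (+pronic k) (+pronic l)))))) ⟩
  pronicSum i j k l ∎

-- Each substitution makes the quadratic form 4 or 8 times `+ 1 + pronicSum i j k l`. Writing this
-- constant as `suc c` lets it be cancelled.
module _ (n c : ℕ) (i j k l : ℤ) {q : ℤ} (eq : q ≡ + suc c * (+ 1 + pronicSum i j k l)) where

  norm⇒value : norm quadruples (i , j , k , l , tt) ≡ n → q ≡ + (suc c ℕ.* suc n)
  norm⇒value p = begin
    q                                        ≡⟨ eq ⟩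
    + suc c * (+ 1 + pronicSum i j k l)      ≡⟨ cong (λ s → + suc c * (+ 1 + s)) (trans (sym (norm≡pronicSum i j k l)) (cong +_ p)) ⟩
    + suc c * + suc n                        ≡⟨ ℤ.pos-* (suc c) (suc n) ⟨
    + (suc c ℕ.* suc n)                      ∎

  value⇒norm : q ≡ + (suc c ℕ.* suc n) → norm quadruples (i , j , k , l , tt) ≡ n
  value⇒norm p = ℤ.+-injective (trans (norm≡pronicSum i j k l) (+-cancelˡ (+ 1) (pronicSum i j k l) (+ n)
    (ℤ.*-cancelˡ-≡ (+ suc c) (+ 1 + pronicSum i j k l) (+ suc n)
      (trans (sym eq) (trans p (ℤ.pos-* (suc c) (suc n)))))))

odd-injective : ∀ {i j} → odd i ≡ odd j → i ≡ j
odd-injective {i} {j} eq = ℤ.*-cancelˡ-≡ (+ 2) i j (+-cancelˡ (+ 1) (+ 2 * i) (+ 2 * j) eq)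

sum-difference-injective : ∀ {i j i′ j′} → i + j ≡ i′ + j′ → i - j ≡ i′ - j′ → i ≡ i′ × j ≡ j′
sum-difference-injective {i} {j} {i′} {j′} s d = i≡i′ , +-cancelˡ i′ j j′ (trans (cong (λ m → m + j) (sym i≡i′)) s)
  where
  double : ∀ i j → (i + j) + (i - j) ≡ + 2 * i
  double = solve-∀
  i≡i′ : i ≡ i′
  i≡i′ = ℤ.*-cancelˡ-≡ (+ 2) i i′ (trans (sym (double i j)) (trans (cong₂ _+_ s d) (double i′ j′)))

Q≡ : ∀ x y z w → Q x y z w ≡ x * x + y * y + + 2 * (z * z) + + 2 * (w * w)
Q≡ x y z w = cong₂ _+_ (cong₂ _+_ (cong₂ _+_ (square x) (square y)) (cong (+ 2 *_) (square z))) (cong (+ 2 *_) (square w))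
  where
  square : ∀ x → x * (x * + 1) ≡ x * x
  square x = cong (x *_) (ℤ.*-identityʳ x)

P₁ P₂ P₃ : ℕ → ℤ⁴ → Set
P₁ m (x , y , z , w) = Q x y z w ≡ + (4 ℕ.* m) × (Even x × Even y) × (Odd z × Odd w)
P₂ m (x , y , z , w) = Q x y z w ≡ + (8 ℕ.* m) × (Even x × Even y) × (Odd z × Odd w)
P₃ m (x , y , z , w) = Q x y z w ≡ + (4 ℕ.* m) × (Odd x × Odd y) × DifferentParity z w

unpair⁴ : ∀ {x y z w x′ y′ z′ w′ : ℤ} → (x , y , z , w) ≡ (x′ , y′ , z′ , w′) →
          x ≡ x′ × y ≡ y′ × z ≡ z′ × w ≡ w′
unpair⁴ refl = refl , refl , refl , refl

pair⁴ : ∀ {x y z w x′ y′ z′ w′ : ℤ} → x ≡ x′ → y ≡ y′ → z ≡ z′ → w ≡ w′ →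
        (x , y , z , w) ≡ (x′ , y′ , z′ , w′)
pair⁴ refl refl refl refl = refl

quadruple : ∀ {x y z w x′ y′ z′ w′ : ℤ} → x ≡ x′ × y ≡ y′ → z ≡ z′ × w ≡ w′ →
            _≡_ {A = X} (x , y , z , w , tt) (x′ , y′ , z′ , w′ , tt)
quadruple (refl , refl) (refl , refl) = refl

odd≢2* : ∀ i j → odd i ≢ + 2 * j
odd≢2* i j eq = odd-odd i refl (even-2* j eq)

complement : ∀ i j {s} → i + j ≡ s → j ≡ s - i
complement i j refl = poly i j
  where
  poly : ∀ i j → j ≡ i + j - i
  poly = solve-∀

-- Third count: x, y odd and z, w of different parity.

map₃ : X → ℤ⁴
map₃ (i , j , k , l , _) = odd i , odd j , k + l + + 1 , k - l

-- Since 2z²+2w² = (z+w)²+(z-w)², with z+w = 2k+1 and z-w = 2l+1, the form becomes a sum of four odd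
-- squares.
Q-map₃ : ∀ i j k l → Q (odd i) (odd j) (k + l + + 1) (k - l) ≡ + 4 * (+ 1 + pronicSum i j k l)
Q-map₃ i j k l = trans (Q≡ (odd i) (odd j) (k + l + + 1) (k - l)) (poly i j k l)
  where
  poly : ∀ i j k l →
    (+ 1 + + 2 * i) * (+ 1 + + 2 * i) + (+ 1 + + 2 * j) * (+ 1 + + 2 * j)
      + + 2 * ((k + l + + 1) * (k + l + + 1)) + + 2 * ((k - l) * (k - l))
    ≡ + 4 * (+ 1 + (i * (i + + 1) + (j * (j + + 1) + (k * (k + + 1) + l * (l + + 1)))))
  poly = solve-∀

Enum-P₃ : ∀ n → Enum (P₃ (suc n)) (map map₃ (level quadruples n))
Enum-P₃ n = Enum-map map₃ (λ {x} → into {x}) (λ {x} {y} → injective {x} {y}) onto (enum quadruples n)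
  where
  different : ∀ k l → DifferentParity (k + l + + 1) (k - l)
  different k l with parity (k - l)
  ... | inj₁ (h , eq) = inj₂
    (odd-odd (h + l) (trans (poly k l) (trans (cong (λ d → d + + 2 * l + + 1) eq) (poly′ h l))) , even-2* h eq)
    where
    poly : ∀ k l → k + l + + 1 ≡ (k - l) + + 2 * l + + 1
    poly = solve-∀
    poly′ : ∀ h l → + 2 * h + + 2 * l + + 1 ≡ + 1 + + 2 * (h + l)
    poly′ = solve-∀
  ... | inj₂ (h , eq) = inj₁
    (even-2* (h + l + + 1) (trans (poly k l) (trans (cong (λ d → d + + 2 * l + + 1) eq) (poly′ h l))) , odd-odd h eq)
    where
    poly : ∀ k l → k + l + + 1 ≡ (k - l) + + 2 * l + + 1
    poly = solve-∀
    poly′ : ∀ h l → + 1 + + 2 * h + + 2 * l + + 1 ≡ + 2 * (h + l + + 1)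
    poly′ = solve-∀
  into : ∀ {x} → norm quadruples x ≡ n → P₃ (suc n) (map₃ x)
  into {i , j , k , l , _} p = norm⇒value n 3 i j k l (Q-map₃ i j k l) p , (odd-odd i refl , odd-odd j refl) , different k l
  injective : ∀ {x y} → norm quadruples x ≡ n → norm quadruples y ≡ n → map₃ x ≡ map₃ y → x ≡ y
  injective {i , j , k , l , _} {i′ , j′ , k′ , l′ , _} _ _ eq =
    let p , q , r , s = unpair⁴ eq
    in quadruple (odd-injective p , odd-injective q)
                 (sum-difference-injective (+-cancelʳ (+ 1) (k + l) (k′ + l′) r) s)
  onto′ : ∀ i j k l {x y z w} → (x , y , z , w) ≡ (odd i , odd j , k + l + + 1 , k - l) →
          Q x y z w ≡ + (4 ℕ.* suc n) → ∃ λ v → norm quadruples v ≡ n × (x , y , z , w) ≡ map₃ v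
  onto′ i j k l refl q = (i , j , k , l , tt) , value⇒norm n 3 i j k l (Q-map₃ i j k l) q , refl
  onto : ∀ {y} → P₃ (suc n) y → ∃ λ x → norm quadruples x ≡ n × y ≡ map₃ x
  onto {x , y , z , w} (q , (ox , oy) , par) with odd⇒odd x ox | odd⇒odd y oy | par
  ... | i , refl | j , refl | inj₁ (ez , ow) with even⇒2* z ez | odd⇒odd w ow
  -- The last two coordinates solve z+w = 2k+1 and z-w = 2l+1 for z = 2a and w = 2b+1.
  ... | a , refl | b , refl = onto′ i j (a + b) (a - b - + 1) (pair⁴ refl refl (poly a b) (poly′ a b)) q
    where
    poly : ∀ a b → + 2 * a ≡ (a + b) + (a - b - + 1) + + 1
    poly = solve-∀
    poly′ : ∀ a b → + 1 + + 2 * b ≡ (a + b) - (a - b - + 1)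
    poly′ = solve-∀
  onto {x , y , z , w} (q , (ox , oy) , par) | i , refl | j , refl | inj₂ (oz , ew) with odd⇒odd z oz | even⇒2* w ew
  ... | a , refl | b , refl = onto′ i j (a + b) (a - b) (pair⁴ refl refl (poly a b) (poly′ a b)) q
    where
    poly : ∀ a b → + 1 + + 2 * a ≡ (a + b) + (a - b) + + 1
    poly = solve-∀
    poly′ : ∀ a b → + 2 * b ≡ (a + b) - (a - b)
    poly′ = solve-∀

-- Second count: the value 8m with x, y even and z, w odd.

map₂ : X → ℤ⁴
map₂ (i , j , k , l , _) = + 2 * (i + j + + 1) , + 2 * (i - j) , odd k , odd l

-- Here x²+y² = 2((2i+1)²+(2j+1)²), so the form is twice a sum of four odd squares.
Q-map₂ : ∀ i j k l → Q (+ 2 * (i + j + + 1)) (+ 2 * (i - j)) (odd k) (odd l) ≡ + 8 * (+ 1 + pronicSum i j k l)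
Q-map₂ i j k l = trans (Q≡ (+ 2 * (i + j + + 1)) (+ 2 * (i - j)) (odd k) (odd l)) (poly i j k l)
  where
  poly : ∀ i j k l →
    + 2 * (i + j + + 1) * (+ 2 * (i + j + + 1)) + + 2 * (i - j) * (+ 2 * (i - j))
      + + 2 * ((+ 1 + + 2 * k) * (+ 1 + + 2 * k)) + + 2 * ((+ 1 + + 2 * l) * (+ 1 + + 2 * l))
    ≡ + 8 * (+ 1 + (i * (i + + 1) + (j * (j + + 1) + (k * (k + + 1) + l * (l + + 1)))))
  poly = solve-∀

Enum-P₂ : ∀ n → Enum (P₂ (suc n)) (map map₂ (level quadruples n))
Enum-P₂ n = Enum-map map₂ (λ {x} → into {x}) (λ {x} {y} → injective {x} {y}) onto (enum quadruples n)
  where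
  into : ∀ {x} → norm quadruples x ≡ n → P₂ (suc n) (map₂ x)
  into {i , j , k , l , _} p =
    norm⇒value n 7 i j k l (Q-map₂ i j k l) p , (even-2* (i + j + + 1) refl , even-2* (i - j) refl) , odd-odd k refl , odd-odd l refl
  injective : ∀ {x y} → norm quadruples x ≡ n → norm quadruples y ≡ n → map₂ x ≡ map₂ y → x ≡ y
  injective {i , j , k , l , _} {i′ , j′ , k′ , l′ , _} _ _ eq =
    let p , q , r , s = unpair⁴ eq
    in quadruple (sum-difference-injective
                   (+-cancelʳ (+ 1) (i + j) (i′ + j′) (ℤ.*-cancelˡ-≡ (+ 2) (i + j + + 1) (i′ + j′ + + 1) p))
                   (ℤ.*-cancelˡ-≡ (+ 2) (i - j) (i′ - j′) q))
                 (odd-injective r , odd-injective s)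
  onto′ : ∀ a b k l → Q (+ 2 * a) (+ 2 * b) (odd k) (odd l) ≡ + (8 ℕ.* suc n) →
          ∃ λ v → norm quadruples v ≡ n × (+ 2 * a , + 2 * b , odd k , odd l) ≡ map₂ v
  onto′ a b k l q with parity (a + b)
  -- If a+b is even, the form is 4 times an odd number and cannot be 8m.
  ... | inj₁ (s , eq) rewrite complement a b eq = ⊥-elim (odd≢2* r (+ suc n) (ℤ.*-cancelˡ-≡ (+ 4) (odd r) (+ 2 * + suc n)
        (trans (sym (poly a s k l)) (trans (sym (Q≡ (+ 2 * a) (+ 2 * (+ 2 * s - a)) (odd k) (odd l)))
          (trans q (trans (ℤ.pos-* 8 (suc n)) (ℤ.*-assoc (+ 4) (+ 2) (+ suc n))))))))
    where
    r = a * a - + 2 * a * s + + 2 * s * s + k * (k + + 1) + l * (l + + 1)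
    poly : ∀ a s k l →
      + 2 * a * (+ 2 * a) + + 2 * (+ 2 * s - a) * (+ 2 * (+ 2 * s - a))
        + + 2 * ((+ 1 + + 2 * k) * (+ 1 + + 2 * k)) + + 2 * ((+ 1 + + 2 * l) * (+ 1 + + 2 * l))
      ≡ + 4 * (+ 1 + + 2 * (a * a - + 2 * a * s + + 2 * s * s + k * (k + + 1) + l * (l + + 1)))
    poly = solve-∀
  -- From a = i+j+1 and b = i-j follows a+b = 2i+1, hence i = s and j = a-s-1.
  ... | inj₂ (s , eq) rewrite complement a b eq = v , value⇒norm n 7 s (a - s - + 1) k l (Q-map₂ s (a - s - + 1) k l)
        (trans (cong₂ (λ x y → Q x y (odd k) (odd l)) (sym (poly a s)) (sym (poly′ a s))) q)
      , pair⁴ (poly a s) (poly′ a s) refl refl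
    where
    v : X
    v = s , a - s - + 1 , k , l , tt
    poly : ∀ a s → + 2 * a ≡ + 2 * (s + (a - s - + 1) + + 1)
    poly = solve-∀
    poly′ : ∀ a s → + 2 * (+ 1 + + 2 * s - a) ≡ + 2 * (s - (a - s - + 1))
    poly′ = solve-∀
  onto : ∀ {y} → P₂ (suc n) y → ∃ λ x → norm quadruples x ≡ n × y ≡ map₂ x
  onto {x , y , z , w} (q , (ex , ey) , oz , ow) with even⇒2* x ex | even⇒2* y ey | odd⇒odd z oz | odd⇒odd w ow
  ... | a , refl | b , refl | k , refl | l , refl = onto′ a b k l q

-- First count: the value 4m with x, y even and z, w odd.

E₁ E₂ : X → Set
E₁ (i , j , _ , _ , _) = Even (i + j)
E₂ (_ , _ , k , l , _) = Even (k + l)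

E₁? : Decidable E₁
E₁? (i , j , _ , _ , _) = even? (i + j)

E₂? : Decidable E₂
E₂? (_ , _ , k , l , _) = even? (k + l)

evenSums : ℕ → List X
evenSums n = filter E₂? (filter E₁? (level quadruples n))

Enum-evenSums : ∀ n → Enum (λ x → (norm quadruples x ≡ n × E₁ x) × E₂ x) (evenSums n)
Enum-evenSums n = Enum-filter E₂? (Enum-filter E₁? (enum quadruples n))

-- Replacing j by -1-j keeps its pronic number and changes the parity of i+j; likewise for l and
-- k+l. Each of the two conditions therefore selects exactly half.
length-evenSums : ∀ n → + length (level quadruples n) ≡ + 4 * + length (evenSums n)
length-evenSums n = begin
  + length (level quadruples n)          ≡⟨ ∑-one (level quadruples n) ⟨
  ∑ (level quadruples n) (λ _ → + 1)     ≡⟨ ∑-halve E₁? flip₁ (λ {x} → flip₁-into {x}) flip₁-involutive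
                                             (λ {x} → even⇒odd (proj₁ x) _) (λ {x} → odd⇒even (proj₁ x) _)
                                             (enum quadruples n) (λ _ → + 1) (λ _ → refl) ⟩
  + 2 * ∑ (filter E₁? (level quadruples n)) (λ _ → + 1)
    ≡⟨ cong (+ 2 *_) (∑-halve E₂? flip₂ (λ {x} (p , q) → flip₂-into {x} p , q) flip₂-involutive
         (λ {x} → even⇒odd (third x) _) (λ {x} → odd⇒even (third x) _)
         (Enum-filter E₁? (enum quadruples n)) (λ _ → + 1) (λ _ → refl)) ⟩
  + 2 * (+ 2 * ∑ (evenSums n) (λ _ → + 1)) ≡⟨ ℤ.*-assoc (+ 2) (+ 2) (∑ (evenSums n) (λ _ → + 1)) ⟨
  + 4 * ∑ (evenSums n) (λ _ → + 1)       ≡⟨ cong (+ 4 *_) (∑-one (evenSums n)) ⟩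
  + 4 * + length (evenSums n)            ∎
  where
  third : X → ℤ
  third (_ , _ , k , _ , _) = k
  flip₁ flip₂ : X → X
  flip₁ (i , j , k , l , _) = i , - + 1 - j , k , l , tt
  flip₂ (i , j , k , l , _) = i , j , k , - + 1 - l , tt
  pronic-flip : ∀ j → pronic (- + 1 - j) ≡ pronic j
  pronic-flip j = ℤ.+-injective (trans (+pronic (- + 1 - j)) (trans (poly j) (sym (+pronic j))))
    where
    poly : ∀ j → (- + 1 - j) * ((- + 1 - j) + + 1) ≡ j * (j + + 1)
    poly = solve-∀
  flip₁-into : ∀ {x} → norm quadruples x ≡ n → norm quadruples (flip₁ x) ≡ n
  flip₁-into {i , j , k , l , _} = trans (cong (λ p → pronic i ℕ.+ (p ℕ.+ (pronic k ℕ.+ (pronic l ℕ.+ 0)))) (pronic-flip j))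
  flip₂-into : ∀ {x} → norm quadruples x ≡ n → norm quadruples (flip₂ x) ≡ n
  flip₂-into {i , j , k , l , _} = trans (cong (λ p → pronic i ℕ.+ (pronic j ℕ.+ (pronic k ℕ.+ (p ℕ.+ 0)))) (pronic-flip l))
  flip-flip : ∀ j → - + 1 - (- + 1 - j) ≡ j
  flip-flip = solve-∀
  flip₁-involutive : ∀ x → flip₁ (flip₁ x) ≡ x
  flip₁-involutive (i , j , k , l , _) = cong (λ j → i , j , k , l , tt) (flip-flip j)
  flip₂-involutive : ∀ x → flip₂ (flip₂ x) ≡ x
  flip₂-involutive (i , j , k , l , _) = cong (λ l → i , j , k , l , tt) (flip-flip l)
  reflect : ∀ i j → i + (- + 1 - j) ≡ (i + j) - + 1 - + 2 * j
  reflect = solve-∀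
  even⇒odd : ∀ i j → Even (i + j) → Odd (i + (- + 1 - j))
  even⇒odd i j ev with even⇒2* (i + j) ev
  ... | h , eq = odd-odd (h - j - + 1) (trans (reflect i j) (trans (cong (λ s → s - + 1 - + 2 * j) eq) (poly h j)))
    where
    poly : ∀ h j → + 2 * h - + 1 - + 2 * j ≡ + 1 + + 2 * (h - j - + 1)
    poly = solve-∀
  odd⇒even : ∀ i j → Odd (i + j) → Even (i + (- + 1 - j))
  odd⇒even i j od with odd⇒odd (i + j) od
  ... | h , eq = even-2* (h - j) (trans (reflect i j) (trans (cong (λ s → s - + 1 - + 2 * j) eq) (poly h j)))
    where
    poly : ∀ h j → + 1 + + 2 * h - + 1 - + 2 * j ≡ + 2 * (h - j)
    poly = solve-∀

length-evenSums-σ : ∀ n → Odd (+ suc n) → length (evenSums n) ≡ 4 ℕ.* σ (suc n)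
length-evenSums-σ n od = ℕ.*-cancelˡ-≡ _ _ 4 (begin
  4 ℕ.* length (evenSums n)         ≡⟨ ℤ.+-injective (trans (length-evenSums n) (sym (ℤ.pos-* 4 (length (evenSums n))))) ⟨
  length (level quadruples n)       ≡⟨ length-quadruples n od ⟩
  16 ℕ.* σ (suc n)                  ≡⟨ ℕ.*-assoc 4 4 (σ (suc n)) ⟩
  4 ℕ.* (4 ℕ.* σ (suc n))           ∎)

map₁ : X → ℤ⁴
map₁ (i , j , k , l , _) = (i - j) + (k - l) , (i - j) - (k - l) , i + j + + 1 , k + l + + 1

-- The parallelogram law is used twice: x²+y² = 2(i-j)²+2(k-l)², and 2(i-j)²+2(i+j+1)² =
-- (2i+1)²+(2j+1)², likewise for k and l.
Q-map₁ : ∀ i j k l → Q ((i - j) + (k - l)) ((i - j) - (k - l)) (i + j + + 1) (k + l + + 1)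
         ≡ + 4 * (+ 1 + pronicSum i j k l)
Q-map₁ i j k l = trans (Q≡ ((i - j) + (k - l)) ((i - j) - (k - l)) (i + j + + 1) (k + l + + 1)) (poly i j k l)
  where
  poly : ∀ i j k l →
    ((i - j) + (k - l)) * ((i - j) + (k - l)) + ((i - j) - (k - l)) * ((i - j) - (k - l))
      + + 2 * ((i + j + + 1) * (i + j + + 1)) + + 2 * ((k + l + + 1) * (k + l + + 1))
    ≡ + 4 * (+ 1 + (i * (i + + 1) + (j * (j + + 1) + (k * (k + + 1) + l * (l + + 1)))))
  poly = solve-∀

Enum-P₁ : ∀ n → Odd (+ suc n) → Enum (P₁ (suc n)) (map map₁ (evenSums n))
Enum-P₁ n od = Enum-map map₁ (λ {x} → into {x}) (λ {x} {y} → injective {x} {y}) onto (Enum-evenSums n)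
  where
  In : X → Set
  In x = (norm quadruples x ≡ n × E₁ x) × E₂ x
  into : ∀ {x} → In x → P₁ (suc n) (map₁ x)
  into {i , j , k , l , _} ((p , e₁) , e₂) with even⇒2* (i + j) e₁ | even⇒2* (k + l) e₂
  ... | s , eq | t , eq′ =
    norm⇒value n 3 i j k l (Q-map₁ i j k l) p
    , (even-2* (s - j + (t - l)) (trans (poly i j k l)
          (trans (cong₂ (λ p q → p - + 2 * j + (q - + 2 * l)) eq eq′) (poly′ s j t l)))
      , even-2* (s - j - (t - l)) (trans (poly″ i j k l)
          (trans (cong₂ (λ p q → p - + 2 * j - (q - + 2 * l)) eq eq′) (poly‴ s j t l))))
    , odd-odd s (trans (cong (λ p → p + + 1) eq) (ℤ.+-comm (+ 2 * s) (+ 1)))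
    , odd-odd t (trans (cong (λ p → p + + 1) eq′) (ℤ.+-comm (+ 2 * t) (+ 1)))
    where
    poly : ∀ i j k l → (i - j) + (k - l) ≡ (i + j) - + 2 * j + ((k + l) - + 2 * l)
    poly = solve-∀
    poly′ : ∀ s j t l → + 2 * s - + 2 * j + (+ 2 * t - + 2 * l) ≡ + 2 * (s - j + (t - l))
    poly′ = solve-∀
    poly″ : ∀ i j k l → (i - j) - (k - l) ≡ (i + j) - + 2 * j - ((k + l) - + 2 * l)
    poly″ = solve-∀
    poly‴ : ∀ s j t l → + 2 * s - + 2 * j - (+ 2 * t - + 2 * l) ≡ + 2 * (s - j - (t - l))
    poly‴ = solve-∀
  injective : ∀ {x y} → In x → In y → map₁ x ≡ map₁ y → x ≡ y
  injective {i , j , k , l , _} {i′ , j′ , k′ , l′ , _} _ _ eq =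
    let p , q , r , s = unpair⁴ eq
        d , d′ = sum-difference-injective {i - j} {k - l} {i′ - j′} {k′ - l′} p q
    in quadruple (sum-difference-injective (+-cancelʳ (+ 1) (i + j) (i′ + j′) r) d)
                 (sum-difference-injective (+-cancelʳ (+ 1) (k + l) (k′ + l′) s) d′)
  onto′ : ∀ a b k l → Q (+ 2 * a) (+ 2 * b) (odd k) (odd l) ≡ + (4 ℕ.* suc n) →
          ∃ λ v → In v × (+ 2 * a , + 2 * b , odd k , odd l) ≡ map₁ v
  onto′ a b k l q with parity (a + b)
  -- If a+b is odd, the form is 4 times an even number, so m would be even.
  ... | inj₂ (s , eq) rewrite complement a b eq = ⊥-elim (od (even-2* r (ℤ.*-cancelˡ-≡ (+ 4) (+ suc n) (+ 2 * r)
        (trans (sym (ℤ.pos-* 4 (suc n))) (trans (sym q)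
          (trans (Q≡ (+ 2 * a) (+ 2 * (odd s - a)) (odd k) (odd l)) (poly a s k l)))))))
    where
    r = a * a - a * odd s + + 2 * (s * (s + + 1)) + + 1 + k * (k + + 1) + l * (l + + 1)
    poly : ∀ a s k l →
      + 2 * a * (+ 2 * a) + + 2 * (+ 1 + + 2 * s - a) * (+ 2 * (+ 1 + + 2 * s - a))
        + + 2 * ((+ 1 + + 2 * k) * (+ 1 + + 2 * k)) + + 2 * ((+ 1 + + 2 * l) * (+ 1 + + 2 * l))
      ≡ + 4 * (+ 2 * (a * a - a * (+ 1 + + 2 * s) + + 2 * (s * (s + + 1)) + + 1 + k * (k + + 1) + l * (l + + 1)))
    poly = solve-∀
  -- Half the sum and half the difference of x = 2a and y = 2b are 2s and 2(a-s). These are the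
  -- differences of the first and of the last two coordinates of the preimage, whose sums are z-1 =
  -- 2k and w-1 = 2l.
  ... | inj₁ (s , eq) rewrite complement a b eq =
      v , ((value⇒norm n 3 (k + s) (k - s) (l + (a - s)) (l - (a - s)) (Q-map₁ (k + s) (k - s) (l + (a - s)) (l - (a - s))) (trans (cong Q⁴ (sym eq⁴)) q)
      , even-2* k (poly₁ k s)) , even-2* l (poly₁ l (a - s))) , eq⁴
    where
    v : X
    v = k + s , k - s , l + (a - s) , l - (a - s) , tt
    Q⁴ : ℤ⁴ → ℤ
    Q⁴ (x , y , z , w) = Q x y z w
    poly₁ : ∀ k s → (k + s) + (k - s) ≡ + 2 * k
    poly₁ = solve-∀
    poly₂ : ∀ a s k l → + 2 * a ≡ ((k + s) - (k - s)) + ((l + (a - s)) - (l - (a - s)))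
    poly₂ = solve-∀
    poly₃ : ∀ a s k l → + 2 * (+ 2 * s - a) ≡ ((k + s) - (k - s)) - ((l + (a - s)) - (l - (a - s)))
    poly₃ = solve-∀
    poly₄ : ∀ k s → + 1 + + 2 * k ≡ (k + s) + (k - s) + + 1
    poly₄ = solve-∀
    eq⁴ : (+ 2 * a , + 2 * (+ 2 * s - a) , odd k , odd l) ≡ map₁ v
    eq⁴ = pair⁴ (poly₂ a s k l) (poly₃ a s k l) (poly₄ k s) (poly₄ l (a - s))
  onto : ∀ {y} → P₁ (suc n) y → ∃ λ x → In x × y ≡ map₁ x
  onto {x , y , z , w} (q , (ex , ey) , oz , ow) with even⇒2* x ex | even⇒2* y ey | odd⇒odd z oz | odd⇒odd w ow
  ... | a , refl | b , refl | k , refl | l , refl = onto′ a b k l q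

-- From enumerations to the three cardinalities.

Enum-map⇒HasCardinality : {P : B → Set} (f : A → B) {xs : List A} {c : ℕ} →
                       Enum P (map f xs) → length xs ≡ c → HasCardinality P c
Enum-map⇒HasCardinality {P = P} f {xs} e eq = subst (HasCardinality P) (trans (length-map f xs) eq) (Enum⇒HasCardinality e)

theorem58 : (m : ℕ) → Odd (+ m) →
    HasCardinality
    (λ ((x , y , z , w) : ℤ⁴) → Q x y z w ≡ + (4 ℕ.* m) × (Even x × Even y) × (Odd z × Odd w))
    (4 ℕ.* σ m)
    × HasCardinality
    (λ ((x , y , z , w) : ℤ⁴) → Q x y z w ≡ + (8 ℕ.* m) × (Even x × Even y) × (Odd z × Odd w))
    (16 ℕ.* σ m)
    × HasCardinality
    (λ ((x , y , z , w) : ℤ⁴) → Q x y z w ≡ + (4 ℕ.* m) × (Odd x × Odd y) × DifferentParity z w)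
    (16 ℕ.* σ m)
theorem58 zero    od = ⊥-elim (od (2 ℕ.∣0))
theorem58 (suc n) od =
  Enum-map⇒HasCardinality map₁ (Enum-P₁ n od) (length-evenSums-σ n od)
  , Enum-map⇒HasCardinality map₂ (Enum-P₂ n) (length-quadruples n od)
  , Enum-map⇒HasCardinality map₃ (Enum-P₃ n) (length-quadruples n od)
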